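{- For all finite sets of formulas $\Gamma,\Delta$: if $\Gamma\Vdash^{cf}\Delta$, then the sequent $\Gamma\Rightarrow\Delta$ is provable in $\mathsf{CLp}$.
   Context: Fix a countably infinite set $\mathsf{At}$ of atoms. Formulas are built from atoms and the constant $\bot$ using the binary connectives $\land,\lor,\to$. All contexts are finite sets (not multisets) of formulas; a comma denotes union; a subscript $\mathsf{At}$ indicates a finite set of atoms. An atomic sequent has the form $\Gamma_{\mathsf{At}} \Rightarrow \Delta_{\mathsf{At}}$. An atomic rule has finitely many (possibly zero) atomic sequents as premises and one atomic sequent as conclusion; a rule with zero premises is an atomic axiom. A base is a (possibly empty) set of atomic rules; $\mathcal{C}\supseteq\mathcal{B}$ ($\mathcal{C}$ extends $\mathcal{B}$) if $\mathcal{C}$ contains every rule of $\mathcal{B}$. Derivability $\vdash_{\mathcal{B}}$ of atomic sequents is the least relation such that: (Axiom/Weakening) if an atomic axiom with conclusion $\Gamma_{\mathsf{At}}\Rightarrow\Delta_{\mathsf{At}}$ is in $\mathcal{B}$, then $\vdash_{\mathcal{B}} \Theta_{\mathsf{At}},\Gamma_{\mathsf{At}}\Rightarrow\Delta_{\mathsf{At}},\Sigma_{\mathsf{At}}$ for all sets of atoms $\Theta_{\mathsf{At}},\Sigma_{\mathsf{At}}$; (Mix) if a rule with premises $\Gamma^i_{\mathsf{At}}\Rightarrow\Delta^i_{\mathsf{At}}$ ($1\le i\le n$) and conclusion $\Gamma_{\mathsf{At}}\Rightarrow\Delta_{\mathsf{At}}$ is in $\mathcal{B}$ and $\vdash_{\mathcal{B}}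 \Theta^i_{\mathsf{At}},\Gamma^i_{\mathsf{At}}\Rightarrow\Delta^i_{\mathsf{At}},\Sigma^i_{\mathsf{At}}$ for each $i$, then $\vdash_{\mathcal{B}} \Theta^1_{\mathsf{At}},\dots,\Theta^n_{\mathsf{At}},\Gamma_{\mathsf{At}}\Rightarrow\Delta_{\mathsf{At}},\Sigma^1_{\mathsf{At}},\dots,\Sigma^n_{\mathsf{At}}$. Support $\Vdash_{\mathcal{B}}$: (At) $\Vdash_{\mathcal{B}}\Gamma_{\mathsf{At}}$ iff $\vdash_{\mathcal{B}}\ \Rightarrow\Gamma_{\mathsf{At}}$; ($\land$) $\Vdash_{\mathcal{B}} A\land B,\Gamma$ iff $\Vdash_{\mathcal{B}}A,\Gamma$ and $\Vdash_{\mathcal{B}}B,\Gamma$; ($\lor$) $\Vdash_{\mathcal{B}}A\lor B,\Gamma$ iff $\Vdash_{\mathcal{B}}A,B,\Gamma$; ($\to$) $\Vdash_{\mathcal{B}}A\to B,\Gamma$ iff $A\Vdash_{\mathcal{B}}B,\Gamma$; ($\bot$) $\Vdash_{\mathcal{B}}\bot,\Gamma$ iff $\Vdash_{\mathcal{B}}\Gamma$; (Inf) for $n\ge1$, $\{A^1,\dots,A^n\}\Vdash_{\mathcal{B}}\Delta$ iff for every $\mathcal{C}\supseteq\mathcal{B}$ and all sets of atoms $\Theta^1_{\mathsf{At}},\dots,\Theta^n_{\mathsf{At}}$, if $\Vdash_{\mathcal{C}}\Theta^i_{\mathsf{At}},A^i$ for all $i$ then $\Vdash_{\mathcal{C}}\Theta^1_{\mathsf{At}},\dots,\Theta^n_{\mathsf{At}},\Delta$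 (and $\varnothing\Vdash_{\mathcal{B}}\Delta$ means $\Vdash_{\mathcal{B}}\Delta$). The atomic identity rule $\mathsf{Ainit}$ is the atomic axiom $\Gamma_{\mathsf{At}},p\Rightarrow p,\Delta_{\mathsf{At}}$. $\mathcal{HS}$ is the base consisting of all instances of $\mathsf{Ainit}$. Cut-free validity: $\Gamma\Vdash^{cf}\Delta$ iff $\Gamma\Vdash_{\mathcal{B}}\Delta$ for every base $\mathcal{B}\supseteq\mathcal{HS}$. $\mathsf{CLp}$ is the sequent calculus on sequents $\Gamma\Rightarrow\Delta$ (finite sets of formulas) with rules: $\mathsf{init}$: $\Gamma,A\Rightarrow A,\Delta$; $L\bot$: $\Gamma,\bot\Rightarrow\Delta$; $R\bot$: from $\Gamma\Rightarrow\Delta$ infer $\Gamma\Rightarrow\bot,\Delta$; $L\land$: from $A,B,\Gamma\Rightarrow\Delta$ infer $A\land B,\Gamma\Rightarrow\Delta$; $R\land$: from $\Gamma\Rightarrow\Delta,A$ and $\Gamma'\Rightarrow\Delta',B$ infer $\Gamma,\Gamma'\Rightarrow\Delta,\Delta',A\land B$; $L\lor$: from $A,\Gamma\Rightarrow\Delta$ and $B,\Gamma'\Rightarrow\Delta'$ infer $A\lor B,\Gamma,\Gamma'\Rightarrow\Delta,\Delta'$; $R\lor$: from $\Gamma\Rightarrow\Delta,A,B$ infer $\Gamma\Rightarrow\Delta,A\lor B$; $L\to$: from $\Gamma\Rightarrow\Delta,A$ and $B,\Gamma'\Rightarrow\Delta'$ infer $A\to B,\Gamma,\Gamma'\Rightarrow\Delta,\Delta'$;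 $R\to$: from $A,\Gamma\Rightarrow\Delta,B$ infer $\Gamma\Rightarrow\Delta,A\to B$. -}

module Defs where

open import Data.List.Base using (List; []; _∷_; _++_; map; foldr; concat)
open import Data.List.Membership.Propositional using (_∈_)
open import Data.List.Membership.Propositional.Properties using (∈-++⁺ˡ; ∈-++⁺ʳ; ∈-++⁻; ∈-concat⁺′)
open import Data.List.Properties using (++-assoc; ++-identityʳ)
open import Data.List.Relation.Binary.BagAndSetEquality using (_∼[_]_; set; [_]-Equality)
open import Data.List.Relation.Binary.Pointwise as Pointwise using (Pointwise; []; _∷_)
open import Data.List.Relation.Binary.Subset.Propositional using (_⊆_)
open import Data.List.Relation.Binary.Subset.Propositional.Properties using (∷⁺ʳ; ++⁺ʳ; ++⁺ˡ; map⁺)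
open import Data.List.Relation.Unary.Any using (here; there)
open import Data.Product.Base as Product using (_×_; _,_; proj₁; proj₂; ∃-syntax)
open import Data.Sum.Base using (inj₁; inj₂)
open import Function.Base using (id; _∘_)
open import Function.Bundles using (_⇔_; mk⇔; Equivalence)
open import Function.Related.Propositional using (equivalence)
open import Level using (0ℓ; suc; Lift; lift; lower)
open import Relation.Binary.Bundles using (Setoid)
open import Relation.Binary.PropositionalEquality.Core using (refl; sym; subst; cong)
open import Relation.Unary using (Pred)

private variable
  X At : Set

infix  4 ⊩[_]_ _⊩[_]_ _⊩cf_ _⊢_ CLp⊢_
infix  3 _⇒_ _╱_
infix  4 _≋_ _≈_ _≈ᴿ_
infixr 5 _⊕_
infix  4 _⊇_
infixr 6 _⊃_
infixr 7 _∨_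
infixr 8 _∧_

data Formula (At : Set) : Set where
  atom        : At → Formula At
  bot         : Formula At
  _∧_ _∨_ _⊃_ : Formula At → Formula At → Formula At

-- A finite set is a list considered up to having the same members; union is _++_.
_≋_ : List X → List X → Set
xs ≋ ys = xs ∼[ set ] ys

record Sequent (X : Set) : Set where
  constructor _⇒_
  field
    antecedent succedent : List X

_≈_ : Sequent X → Sequent X → Set
(Γ ⇒ Δ) ≈ (Γ′ ⇒ Δ′) = Γ ≋ Γ′ × Δ ≋ Δ′

_⊕_ : Sequent X → Sequent X → Sequent X
(Γ ⇒ Δ) ⊕ (Γ′ ⇒ Δ′) = Γ ++ Γ′ ⇒ Δ ++ Δ′

⨁ : List (Sequent X) → Sequent X
⨁ = foldr _⊕_ ([] ⇒ [])

record AtomicRule (At : Set) : Set where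
  constructor _╱_
  field
    premises   : List (Sequent At)
    conclusion : Sequent At

_≈ᴿ_ : AtomicRule At → AtomicRule At → Set
(ps ╱ c) ≈ᴿ (ps′ ╱ c′) = Pointwise _≈_ ps ps′ × c ≈ c′

-- Since contexts are sets, a set of atomic rules is a predicate that does not
-- distinguish between different listings of the same rule.
record Base (At : Set) : Set₁ where
  field
    Rule     : Pred (AtomicRule At) 0ℓ
    respects : ∀ {r r′} → r ≈ᴿ r′ → Rule r → Rule r′

open Base public

_⊇_ : Base At → Base At → Set
𝓒 ⊇ 𝓑 = ∀ {r} → Rule 𝓑 r → Rule 𝓒 r

-- In mix, the i-th entry Θⁱ ⇒ Σⁱ of ctxs is the side context of the i-th premise.
-- The constructor resp identifies different listings of the same sequent.
data _⊢_ (𝓑 : Base At) : Sequent At → Set where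
  axiom : ∀ {Γ Δ} → Rule 𝓑 ([] ╱ (Γ ⇒ Δ)) →
          ∀ Θ Σ → 𝓑 ⊢ (Θ ++ Γ ⇒ Δ ++ Σ)
  mix   : ∀ {ps c ctxs} → Rule 𝓑 (ps ╱ c) →
          Pointwise (λ ctx p → 𝓑 ⊢ ctx ⊕ p) ctxs ps →
          𝓑 ⊢ ⨁ ctxs ⊕ c
  resp  : ∀ {s s′} → s ≈ s′ → 𝓑 ⊢ s → 𝓑 ⊢ s′

Support : Set → Set₂
Support At = Base At → List At → Set₁

suppAt : Support At
suppAt 𝓑 Ψ = Lift (suc 0ℓ) (𝓑 ⊢ ([] ⇒ Ψ))

-- Support of a context is defined by recursion on formulas, in continuation-passing
-- style: supp A k 𝓑 Ψ is support in 𝓑 of  A, Γ, Ψ  where Ψ is a set of atoms and k is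
-- support of Γ (in any base, together with any set of atoms). That the result satisfies
-- the defining clauses and depends only on the set of formulas listed is proved below.
supp : Formula At → Support At → Support At
supp (atom p) k 𝓑 Ψ = k 𝓑 (p ∷ Ψ)
supp bot      k 𝓑 Ψ = k 𝓑 Ψ
supp (A ∧ B)  k 𝓑 Ψ = supp A k 𝓑 Ψ × supp B k 𝓑 Ψ
supp (A ∨ B)  k 𝓑 Ψ = supp A (supp B k) 𝓑 Ψ
supp (A ⊃ B)  k 𝓑 Ψ = ∀ 𝓒 → 𝓒 ⊇ 𝓑 → ∀ Θ → supp A suppAt 𝓒 Θ → supp B k 𝓒 (Θ ++ Ψ)

supps : List (Formula At) → Support At
supps Γ = foldr supp suppAt Γ

⊩[_]_ : Base At → List (Formula At) → Set₁
⊩[ 𝓑 ] Γ = supps Γ 𝓑 []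

_⊩[_]_ : List (Formula At) → Base At → List (Formula At) → Set₁
[]        ⊩[ 𝓑 ] Δ = ⊩[ 𝓑 ] Δ
Γ@(_ ∷ _) ⊩[ 𝓑 ] Δ = ∀ 𝓒 → 𝓒 ⊇ 𝓑 → ∀ Θs →
  Pointwise (λ Θ A → ⊩[ 𝓒 ] map atom Θ ++ A ∷ []) Θs Γ →
  ⊩[ 𝓒 ] map atom (concat Θs) ++ Δ

module _ {X : Set} where
  open Setoid ([ equivalence ]-Equality X) public using ()
    renaming (refl to ≋-refl; sym to ≋-sym; trans to ≋-trans)

≈-sym : {s s′ : Sequent X} → s ≈ s′ → s′ ≈ s
≈-sym (e , f) = ≋-sym e , ≋-sym f

≈-trans : {s s′ s″ : Sequent X} → s ≈ s′ → s′ ≈ s″ → s ≈ s″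
≈-trans (e , f) (e′ , f′) = ≋-trans e e′ , ≋-trans f f′

≈ᴿ-sym : {r r′ : AtomicRule At} → r ≈ᴿ r′ → r′ ≈ᴿ r
≈ᴿ-sym (ps , c) = Pointwise.symmetric ≈-sym ps , ≈-sym c

≈ᴿ-trans : {r r′ r″ : AtomicRule At} → r ≈ᴿ r′ → r′ ≈ᴿ r″ → r ≈ᴿ r″
≈ᴿ-trans (ps , c) (ps′ , c′) = Pointwise.transitive ≈-trans ps ps′ , ≈-trans c c′

data Ainit {At : Set} : Pred (AtomicRule At) 0ℓ where
  ainit : ∀ Γ p Δ {r} → ([] ╱ (Γ ++ p ∷ [] ⇒ p ∷ Δ)) ≈ᴿ r → Ainit r

HS : Base At
HS .Rule                       = Ainit
HS .respects e (ainit Γ p Δ f) = ainit Γ p Δ (≈ᴿ-trans f e)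

_⊩cf_ : List (Formula At) → List (Formula At) → Set₁
Γ ⊩cf Δ = ∀ 𝓑 → 𝓑 ⊇ HS → Γ ⊩[ 𝓑 ] Δ

-- As for _⊢_, the constructor resp identifies different listings of the same sequent.
data CLp⊢_ {At : Set} : Sequent (Formula At) → Set where
  init : ∀ {Γ Δ A}           → CLp⊢ (Γ ++ A ∷ [] ⇒ A ∷ Δ)
  L⊥   : ∀ {Γ Δ}             → CLp⊢ (Γ ++ bot ∷ [] ⇒ Δ)
  R⊥   : ∀ {Γ Δ}             → CLp⊢ (Γ ⇒ Δ) → CLp⊢ (Γ ⇒ bot ∷ Δ)
  L∧   : ∀ {Γ Δ A B}         → CLp⊢ (A ∷ B ∷ Γ ⇒ Δ) → CLp⊢ (A ∧ B ∷ Γ ⇒ Δ)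
  R∧   : ∀ {Γ Γ′ Δ Δ′ A B}   → CLp⊢ (Γ ⇒ Δ ++ A ∷ []) → CLp⊢ (Γ′ ⇒ Δ′ ++ B ∷ []) →
         CLp⊢ (Γ ++ Γ′ ⇒ Δ ++ Δ′ ++ A ∧ B ∷ [])
  L∨   : ∀ {Γ Γ′ Δ Δ′ A B}   → CLp⊢ (A ∷ Γ ⇒ Δ) → CLp⊢ (B ∷ Γ′ ⇒ Δ′) →
         CLp⊢ (A ∨ B ∷ Γ ++ Γ′ ⇒ Δ ++ Δ′)
  R∨   : ∀ {Γ Δ A B}         → CLp⊢ (Γ ⇒ Δ ++ A ∷ B ∷ []) → CLp⊢ (Γ ⇒ Δ ++ A ∨ B ∷ [])
  L⊃   : ∀ {Γ Γ′ Δ Δ′ A B}   → CLp⊢ (Γ ⇒ Δ ++ A ∷ []) → CLp⊢ (B ∷ Γ′ ⇒ Δ′) →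
         CLp⊢ (A ⊃ B ∷ Γ ++ Γ′ ⇒ Δ ++ Δ′)
  R⊃   : ∀ {Γ Δ A B}         → CLp⊢ (A ∷ Γ ⇒ Δ ++ B ∷ []) → CLp⊢ (Γ ⇒ Δ ++ A ⊃ B ∷ [])
  resp : ∀ {s s′}            → s ≈ s′ → CLp⊢ s → CLp⊢ s′

-- The lemmas below serve ⊩-At, ⊩-∧, ⊩-∨, ⊩-⊃, ⊩-⊥ (the clauses of support) and ⊩-resp-≋,
-- ⊩-antecedent-resp-≋ (independence of the listing); no earlier definition uses them.

module _ {At : Set} where

  private variable
    𝓑 𝓒     : Base At
    Φ Ψ     : List At
    j k     : Support At
    Γ Γ′    : List (Formula At)

  ⊆-antisym : {xs ys : List X} → xs ⊆ ys → ys ⊆ xs → xs ≋ ys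
  ⊆-antisym p q = mk⇔ p q

  ++-swap : ∀ (xs ys zs : List X) → xs ++ ys ++ zs ⊆ ys ++ xs ++ zs
  ++-swap xs ys zs i with ∈-++⁻ xs i
  ... | inj₁ a = ∈-++⁺ʳ ys (∈-++⁺ˡ a)
  ... | inj₂ b with ∈-++⁻ ys b
  ...   | inj₁ c = ∈-++⁺ˡ c
  ...   | inj₂ d = ∈-++⁺ʳ ys (∈-++⁺ʳ xs d)

  ++-contract : ∀ (xs zs : List X) → xs ++ xs ++ zs ⊆ xs ++ zs
  ++-contract xs zs i with ∈-++⁻ xs i
  ... | inj₁ a = ∈-++⁺ˡ a
  ... | inj₂ b = b

  mutual
    ⊢-extend : 𝓒 ⊇ 𝓑 → ∀ {s} → 𝓑 ⊢ s → 𝓒 ⊢ s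
    ⊢-extend e (axiom r Θ Σ) = axiom (e r) Θ Σ
    ⊢-extend e (mix r ds)    = mix (e r) (⊢-extend* e ds)
    ⊢-extend e (resp q d)    = resp q (⊢-extend e d)

    ⊢-extend* : 𝓒 ⊇ 𝓑 → ∀ {xs ps} → Pointwise (λ x p → 𝓑 ⊢ x ⊕ p) xs ps →
                Pointwise (λ x p → 𝓒 ⊢ x ⊕ p) xs ps
    ⊢-extend* e []       = []
    ⊢-extend* e (d ∷ ds) = ⊢-extend e d ∷ ⊢-extend* e ds

  ⊢-weaken : ∀ {Γ Δ} Σ → 𝓑 ⊢ (Γ ⇒ Δ) → 𝓑 ⊢ (Γ ⇒ Σ ++ Δ)
  ⊢-weaken Σ (axiom {Δ = Δ} r Θ Σ₀) =
    resp (≋-refl , ⊆-antisym (++-swap Δ Σ Σ₀) (++-swap Σ Δ Σ₀)) (axiom r Θ (Σ ++ Σ₀))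
  ⊢-weaken Σ (mix {c = Γ ⇒ Δ} r []) =
    resp (≋-refl , ⊆-antisym (sw Δ Σ) (sw Σ Δ)) (axiom r [] Σ)
    where
    sw : ∀ (xs ys : List At) → xs ++ ys ⊆ ys ++ xs
    sw xs ys i with ∈-++⁻ xs i
    ... | inj₁ a = ∈-++⁺ʳ ys a
    ... | inj₂ b = ∈-++⁺ˡ b
  ⊢-weaken Σ (mix {c = c} {ctxs = (Θ₁ ⇒ Σ₁) ∷ ctxs} r (_∷_ {y = p} d ds)) =
    resp (≋-refl , ⊆-antisym to from)
      (mix {ctxs = (Θ₁ ⇒ Σ ++ Σ₁) ∷ ctxs} r (resp (≋-refl , assoc) (⊢-weaken Σ d) ∷ ds))
    where
    Σs Δ : List At
    Σs = Sequent.succedent (⨁ ctxs)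
    Δ  = Sequent.succedent c
    assoc : Σ ++ Σ₁ ++ Sequent.succedent p ≋ (Σ ++ Σ₁) ++ Sequent.succedent p
    assoc = mk⇔ (subst (_ ∈_) (sym (++-assoc Σ Σ₁ _))) (subst (_ ∈_) (++-assoc Σ Σ₁ _))
    to : (((Σ ++ Σ₁) ++ Σs) ++ Δ) ⊆ (Σ ++ (Σ₁ ++ Σs) ++ Δ)
    to i = subst (_ ∈_) (++-assoc Σ (Σ₁ ++ Σs) Δ) (subst (λ z → _ ∈ z ++ Δ) (++-assoc Σ Σ₁ Σs) i)
    from : (Σ ++ (Σ₁ ++ Σs) ++ Δ) ⊆ (((Σ ++ Σ₁) ++ Σs) ++ Δ)
    from i = subst (λ z → _ ∈ z ++ Δ) (sym (++-assoc Σ Σ₁ Σs)) (subst (_ ∈_) (sym (++-assoc Σ (Σ₁ ++ Σs) Δ)) i)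
  ⊢-weaken Σ (resp (e , f) d) =
    resp (e , ⊆-antisym (++⁺ʳ Σ (Equivalence.to f)) (++⁺ʳ Σ (Equivalence.from f))) (⊢-weaken Σ d)

  Mono : Support At → Set₁
  Mono k = ∀ {𝓑 𝓒 Φ Ψ} → 𝓒 ⊇ 𝓑 → Φ ⊆ Ψ → k 𝓑 Φ → k 𝓒 Ψ

  suppAt-mono : Mono suppAt
  suppAt-mono {Φ = Φ} {Ψ} e Φ⊆Ψ (lift d) =
    lift (resp (≋-refl , ⊆-antisym absorb (∈-++⁺ˡ)) (⊢-weaken Ψ (⊢-extend e d)))
    where
    absorb : Ψ ++ Φ ⊆ Ψ
    absorb i with ∈-++⁻ Ψ i
    ... | inj₁ a = a
    ... | inj₂ b = Φ⊆Ψ b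

  supp-map : ∀ A → (∀ {𝓑 Ψ} → j 𝓑 Ψ → k 𝓑 Ψ) → supp A j 𝓑 Ψ → supp A k 𝓑 Ψ
  supp-map (atom p) f x       = f x
  supp-map bot      f x       = f x
  supp-map (A ∧ B)  f (x , y) = supp-map A f x , supp-map B f y
  supp-map (A ∨ B)  f x       = supp-map A (supp-map B f) x
  supp-map (A ⊃ B)  f x 𝓒 e Θ a = supp-map B f (x 𝓒 e Θ a)

  supp-mono : ∀ A → Mono k → Mono (supp A k)
  supp-mono (atom p) m e s x       = m e (∷⁺ʳ p s) x
  supp-mono bot      m e s x       = m e s x
  supp-mono (A ∧ B)  m e s (x , y) = supp-mono A m e s x , supp-mono B m e s y
  supp-mono (A ∨ B)  m e s x       = supp-mono A (supp-mono B m) e s x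
  supp-mono (A ⊃ B)  m e s x 𝓓 e′ Θ a =
    supp-mono B m id (++⁺ʳ Θ s) (x 𝓓 (e′ ∘ e) Θ a)

  supps-mono : ∀ Γ → Mono (supps Γ)
  supps-mono []      = suppAt-mono
  supps-mono (A ∷ Γ) = supp-mono A (supps-mono Γ)

  supp-weaken : ∀ A → Mono k → k 𝓑 Ψ → supp A k 𝓑 Ψ
  supp-weaken (atom p) m x = m id there x
  supp-weaken bot      m x = x
  supp-weaken (A ∧ B)  m x = supp-weaken A m x , supp-weaken B m x
  supp-weaken (A ∨ B)  m x = supp-weaken A (supp-mono B m) (supp-weaken B m x)
  supp-weaken (A ⊃ B)  m x 𝓒 e Θ _ = supp-weaken B m (m e (∈-++⁺ʳ Θ) x)

  supp-∀ : ∀ A {P : Support At} → Mono k →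
           (∀ 𝓒 → 𝓒 ⊇ 𝓑 → ∀ Θ → P 𝓒 Θ → supp A k 𝓒 (Θ ++ Ψ)) →
           supp A (λ 𝓑 Ψ → ∀ 𝓒 → 𝓒 ⊇ 𝓑 → ∀ Θ → P 𝓒 Θ → k 𝓒 (Θ ++ Ψ)) 𝓑 Ψ
  supp-∀ (atom p) m f 𝓒 e Θ x = m id (++-swap (p ∷ []) Θ _) (f 𝓒 e Θ x)
  supp-∀ bot      m f = f
  supp-∀ (A ∧ B) {P} m f = supp-∀ A {P} m (λ 𝓒 e Θ x → proj₁ (f 𝓒 e Θ x))
                         , supp-∀ B {P} m (λ 𝓒 e Θ x → proj₂ (f 𝓒 e Θ x))
  supp-∀ (A ∨ B) {P} m f = supp-map A (supp-∀ B {P} m) (supp-∀ A {P} (supp-mono B m) f)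
  supp-∀ (A ⊃ B) {P} m f 𝓓 e Φ a = supp-∀ B {P} m λ 𝓒 e′ Θ x →
    supp-mono B m id (++-swap Φ Θ _)
      (f 𝓒 (e′ ∘ e) Θ x 𝓒 id Φ (supp-mono A suppAt-mono e′ id a))

  supp-× : ∀ A → supp A j 𝓑 Ψ → supp A k 𝓑 Ψ → supp A (λ 𝓑 Ψ → j 𝓑 Ψ × k 𝓑 Ψ) 𝓑 Ψ
  supp-× (atom p) x y = x , y
  supp-× bot      x y = x , y
  supp-× (A ∧ B)  (x , x′) (y , y′) = supp-× A x y , supp-× B x′ y′
  supp-× (A ∨ B)  x y = supp-map A (λ (u , v) → supp-× B u v) (supp-× A x y)
  supp-× (A ⊃ B)  x y 𝓒 e Θ a = supp-× B (x 𝓒 e Θ a) (y 𝓒 e Θ a)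

  supp-atom : ∀ A p → Mono k → supp A k 𝓑 (p ∷ Ψ) → supp A (λ 𝓑 Ψ → k 𝓑 (p ∷ Ψ)) 𝓑 Ψ
  supp-atom (atom q) p m x = m id (++-swap (q ∷ []) (p ∷ []) _) x
  supp-atom bot      p m x = x
  supp-atom (A ∧ B)  p m (x , y) = supp-atom A p m x , supp-atom B p m y
  supp-atom (A ∨ B)  p m x = supp-map A (supp-atom B p m) (supp-atom A p (supp-mono B m) x)
  supp-atom (A ⊃ B)  p m x 𝓒 e Θ a =
    supp-atom B p m (supp-mono B m id (++-swap Θ (p ∷ []) _) (x 𝓒 e Θ a))

  supp-comm : ∀ A B → Mono k → supp A (supp B k) 𝓑 Ψ → supp B (supp A k) 𝓑 Ψ
  supp-comm (atom p) B m x = supp-atom B p m x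
  supp-comm bot      B m x = x
  supp-comm (A ∧ A′) B m (x , y) = supp-× B (supp-comm A B m x) (supp-comm A′ B m y)
  supp-comm (A ∨ A′) B m x =
    supp-comm A B (supp-mono A′ m) (supp-map A (supp-comm A′ B m) x)
  supp-comm (A ⊃ A′) B m x =
    supp-∀ B {supp A suppAt} (supp-mono A′ m) (λ 𝓒 e Θ a → supp-comm A′ B m (x 𝓒 e Θ a))

  supp-contract : ∀ A → Mono k → supp A (supp A k) 𝓑 Ψ → supp A k 𝓑 Ψ
  supp-contract (atom p) m x = m id (++-contract (p ∷ []) _) x
  supp-contract bot      m x = x
  supp-contract (A ∧ B)  m (x , y) =
    supp-contract A m (supp-map A proj₁ x) , supp-contract B m (supp-map B proj₂ y)
  supp-contract (A ∨ B)  m x = supp-map A (supp-contract B m)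
    (supp-contract A (supp-mono B (supp-mono B m))
      (supp-map A (supp-comm B A (supp-mono B m)) x))
  supp-contract (A ⊃ B)  m x 𝓒 e Θ a = supp-mono B m id (++-contract Θ _)
    (supp-contract B m (supp-comm B (A ⊃ B) m (x 𝓒 e Θ a) 𝓒 id Θ a))

  supps-absorb : ∀ {A Γ} → A ∈ Γ → supp A (supps Γ) 𝓑 Ψ → supps Γ 𝓑 Ψ
  supps-absorb {Γ = A ∷ Γ} (here refl) x = supp-contract A (supps-mono Γ) x
  supps-absorb {A = A} {Γ = B ∷ Γ} (there i) x =
    supp-map B (supps-absorb i) (supp-comm A B (supps-mono Γ) x)

  supps-⊆ : Γ ⊆ Γ′ → supps Γ 𝓑 Ψ → supps Γ′ 𝓑 Ψ
  supps-⊆ {Γ = []} {Γ′} s x = go Γ′ x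
    where
    go : ∀ Γ → suppAt 𝓑 Ψ → supps Γ 𝓑 Ψ
    go []      x = x
    go (A ∷ Γ) x = supp-weaken A (supps-mono Γ) (go Γ x)
  supps-⊆ {Γ = A ∷ Γ} s x = supps-absorb (s (here refl)) (supp-map A (supps-⊆ (s ∘ there)) x)

  atoms-to : ∀ Θ → supps (map atom Θ ++ Γ) 𝓑 Ψ → supps Γ 𝓑 (Θ ++ Ψ)
  atoms-to []      x = x
  atoms-to {Γ = Γ} (p ∷ Θ) x = supps-mono Γ id (++-swap Θ (p ∷ []) _) (atoms-to Θ x)

  atoms-from : ∀ Θ → supps Γ 𝓑 (Θ ++ Ψ) → supps (map atom Θ ++ Γ) 𝓑 Ψ
  atoms-from []      x = x
  atoms-from {Γ = Γ} (p ∷ Θ) x = atoms-from Θ (supps-mono Γ id (++-swap (p ∷ []) Θ _) x)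

  ⊩-resp-≋ : Γ ≋ Γ′ → ⊩[ 𝓑 ] Γ → ⊩[ 𝓑 ] Γ′
  ⊩-resp-≋ e = supps-⊆ (Equivalence.to e)

  ⊩-At : ∀ Θ → (⊩[ 𝓑 ] map atom Θ) ⇔ 𝓑 ⊢ ([] ⇒ Θ)
  ⊩-At {𝓑 = 𝓑} Θ = mk⇔ (lower ∘ to Θ) (from Θ ∘ lift)
    where
    to : ∀ Θ → ⊩[ 𝓑 ] map atom Θ → suppAt 𝓑 Θ
    to Θ x = subst (suppAt 𝓑) (++-identityʳ Θ)
      (atoms-to {Γ = []} Θ (subst (⊩[ 𝓑 ]_) (sym (++-identityʳ (map atom Θ))) x))
    from : ∀ Θ → suppAt 𝓑 Θ → ⊩[ 𝓑 ] map atom Θ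
    from Θ x = subst (⊩[ 𝓑 ]_) (++-identityʳ (map atom Θ))
      (atoms-from {Γ = []} Θ (subst (suppAt 𝓑) (sym (++-identityʳ Θ)) x))

  ⊩-∧ : ∀ A B Γ → (⊩[ 𝓑 ] A ∧ B ∷ Γ) ⇔ ((⊩[ 𝓑 ] A ∷ Γ) × (⊩[ 𝓑 ] B ∷ Γ))
  ⊩-∧ A B Γ = mk⇔ id id

  ⊩-∨ : ∀ A B Γ → (⊩[ 𝓑 ] A ∨ B ∷ Γ) ⇔ (⊩[ 𝓑 ] A ∷ B ∷ Γ)
  ⊩-∨ A B Γ = mk⇔ id id

  ⊩-⊃ : ∀ A B Γ → (⊩[ 𝓑 ] A ⊃ B ∷ Γ) ⇔ (A ∷ [] ⊩[ 𝓑 ] B ∷ Γ)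
  ⊩-⊃ {𝓑 = 𝓑} A B Γ = mk⇔ to from
    where
    to : ⊩[ 𝓑 ] A ⊃ B ∷ Γ → A ∷ [] ⊩[ 𝓑 ] B ∷ Γ
    to x 𝓒 e (Θ ∷ []) (a ∷ []) = atoms-from {Γ = B ∷ Γ} (Θ ++ [])
      (subst (supps (B ∷ Γ) 𝓒) (cong (_++ []) (sym (++-identityʳ Θ)))
        (x 𝓒 e Θ (subst (supp A suppAt 𝓒) (++-identityʳ Θ) (atoms-to {Γ = A ∷ []} Θ a))))
    from : A ∷ [] ⊩[ 𝓑 ] B ∷ Γ → ⊩[ 𝓑 ] A ⊃ B ∷ Γ
    from x 𝓒 e Θ a = subst (λ z → supps (B ∷ Γ) 𝓒 (z ++ [])) (++-identityʳ Θ)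
      (atoms-to {Γ = B ∷ Γ} (Θ ++ []) (x 𝓒 e (Θ ∷ [])
        (atoms-from {Γ = A ∷ []} Θ (subst (supp A suppAt 𝓒) (sym (++-identityʳ Θ)) a) ∷ [])))

  ⊩-⊥ : ∀ Γ → (⊩[ 𝓑 ] bot ∷ Γ) ⇔ (⊩[ 𝓑 ] Γ)
  ⊩-⊥ Γ = mk⇔ id id

  private
    AllAt : Base At → List (List At) → List (Formula At) → Set₁
    AllAt 𝓒 = Pointwise (λ Θ A → ⊩[ 𝓒 ] map atom Θ ++ A ∷ [])

    uniform : ∀ {Δ} Γ → Γ ⊩[ 𝓑 ] Δ → ∀ 𝓒 → 𝓒 ⊇ 𝓑 → ∀ Θs → AllAt 𝓒 Θs Γ →
              ⊩[ 𝓒 ] map atom (concat Θs) ++ Δ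
    uniform {Δ = Δ} []      x 𝓒 e [] [] = supps-mono Δ e id x
    uniform         (_ ∷ _) x = x

    pick : ∀ {A Γ Θs} → AllAt 𝓒 Θs Γ → A ∈ Γ →
           ∃[ Θ ] Θ ∈ Θs × (⊩[ 𝓒 ] map atom Θ ++ A ∷ [])
    pick (x ∷ xs) (here refl) = _ , here refl , x
    pick (x ∷ xs) (there i)   = Product.map₂ (Product.map₁ there) (pick xs i)

    select : ∀ {Γ Γ′ Θs} → AllAt 𝓒 Θs Γ′ → Γ ⊆ Γ′ →
             ∃[ Θs′ ] AllAt 𝓒 Θs′ Γ × concat Θs′ ⊆ concat Θs
    select {Γ = []}        xs s = [] , [] , λ ()
    select {Γ = A ∷ Γ} {Θs = Θs} xs s with pick xs (s (here refl)) | select xs (s ∘ there)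
    ... | Θ , i , x | Θs′ , ys , t = Θ ∷ Θs′ , x ∷ ys , sub
      where
      sub : Θ ++ concat Θs′ ⊆ concat Θs
      sub j with ∈-++⁻ Θ j
      ... | inj₁ a = ∈-concat⁺′ a i
      ... | inj₂ b = t b

  ⊩-antecedent-resp-≋ : ∀ {Δ} → Γ ≋ Γ′ → Γ ⊩[ 𝓑 ] Δ → Γ′ ⊩[ 𝓑 ] Δ
  ⊩-antecedent-resp-≋ {Γ = Γ} {Γ′ = []}     {Δ = Δ} e x = main
    where
    main : ⊩[ _ ] Δ
    main with select {Γ = Γ} [] (Equivalence.to e)
    ... | Θs , ys , t = supps-⊆ (drop (concat Θs) t) (uniform Γ x _ id Θs ys)
      where
      drop : ∀ Θ → Θ ⊆ [] → map atom Θ ++ Δ ⊆ Δ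
      drop []      _ i = i
      drop (p ∷ Θ) t i with () ← t (here refl)
  ⊩-antecedent-resp-≋ {Γ = Γ} {Γ′ = _ ∷ _} {Δ = Δ} e x 𝓒 e′ Θs xs with select {Γ = Γ} xs (Equivalence.to e)
  ... | Θs′ , ys , t = supps-⊆ (++⁺ˡ Δ (map⁺ atom t)) (uniform Γ x 𝓒 e′ Θs′ ys)

{-# OPTIONS --safe #-}

-- For a valuation V, let 𝓑 be the base of all atomic rules that preserve truth under V.
-- It contains HS, and it contains the axiom ⇒ p for every true p and the rule from ⇒ p
-- to ⇒ for every false p. These two kinds of rules force support in every extension of 𝓑
-- to agree with classical truth: a true formula is supported, and a false one can be
-- erased from a supported context. As 𝓑 itself derives only sequents true under V, cut-free
-- validity implies classical validity. Every classically valid sequent is provable in CLp,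
-- because the rules are invertible and a valid atomic sequent is an instance of init.
module Submission where

open import Algebra.Bundles using (CommutativeMonoid)
open import Data.Empty using (⊥)
open import Data.List.Base using (List; []; _∷_; _++_; map; concat)
open import Data.List.Membership.DecPropositional using () renaming (_∈?_ to mem?)
open import Data.List.Membership.Propositional using (_∈_; find)
open import Data.List.Membership.Propositional.Properties using (∈-++⁺ˡ; ∈-map⁺; ∈-∃++)
open import Data.List.Properties using (++-assoc; ++-identityʳ)
open import Data.List.Relation.Binary.BagAndSetEquality using (set; commutativeMonoid; ++-cong; ++-idempotent)
open import Data.List.Relation.Binary.Pointwise using (Pointwise; []; _∷_)
open import Data.List.Relation.Binary.Subset.Propositional.Properties using (All-resp-⊇; Any-resp-⊆)
open import Data.List.Relation.Unary.All as All using (All; []; _∷_)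
open import Data.List.Relation.Unary.All.Properties as Allₚ using (¬Any⇒All¬)
open import Data.List.Relation.Unary.Any using (Any; here; there; any?)
open import Data.List.Relation.Unary.Any.Properties as Anyₚ using ()
open import Data.Nat.Base using (ℕ)
open import Data.Nat.Properties using (_≟_)
open import Data.Product.Base using (_×_; _,_; proj₁; proj₂)
open import Data.Sum.Base using (_⊎_; inj₁; inj₂; [_,_]′)
open import Function.Base using (id; _∘_; case_of_)
open import Function.Bundles using (_↔_; Equivalence)
open import Function.Properties.Inverse using (↔⇒↣)
open import Level using (0ℓ; lift; lower)
open import Relation.Binary.Definitions using (DecidableEquality)
open import Relation.Binary.PropositionalEquality.Core using (_≡_; refl; sym; subst)
open import Relation.Nullary.Decidable using (Dec; yes; no; _×-dec_; _⊎-dec_; _→-dec_; via-injection)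
open import Relation.Nullary.Negation using (¬_; contradiction)
open import Relation.Unary using (Pred; Decidable)
open import Defs

private variable
  X At : Set

-- Equality of lists as sets.

≡⇒≋ : {xs ys : List X} → xs ≡ ys → xs ≋ ys
≡⇒≋ refl = ≋-refl

++-comm-≋ : (xs ys : List X) → xs ++ ys ≋ ys ++ xs
++-comm-≋ {X = X} = CommutativeMonoid.comm (commutativeMonoid set X)

∷-swap-≋ : ∀ (x : X) xs ys → xs ++ x ∷ ys ≋ x ∷ xs ++ ys
∷-swap-≋ {X = X} x xs ys =
  ⊆-antisym {At = X} (++-swap {At = X} xs (x ∷ []) ys) (++-swap {At = X} (x ∷ []) xs ys)

-- Classical truth and validity of sequents.

Holds : Pred X 0ℓ → Pred (Sequent X) 0ℓ
Holds P (Γ ⇒ Δ) = All P Γ → Any P Δ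

Holds-resp : ∀ {P : Pred X 0ℓ} {s s′} → s ≈ s′ → Holds P s → Holds P s′
Holds-resp (e , f) h = Any-resp-⊆ (Equivalence.to f) ∘ h ∘ All-resp-⊇ (Equivalence.to e)

infix 4 _⊨_ _⊨?_

_⊨_ : Pred At 0ℓ → Pred (Formula At) 0ℓ
V ⊨ atom p = V p
V ⊨ bot    = ⊥
V ⊨ A ∧ B  = (V ⊨ A) × (V ⊨ B)
V ⊨ A ∨ B  = (V ⊨ A) ⊎ (V ⊨ B)
V ⊨ A ⊃ B  = V ⊨ A → V ⊨ B

_⊨?_ : {V : Pred At 0ℓ} → Decidable V → Decidable (V ⊨_)
V? ⊨? atom p = V? p
V? ⊨? bot    = no id
V? ⊨? A ∧ B  = (V? ⊨? A) ×-dec (V? ⊨? B)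
V? ⊨? A ∨ B  = (V? ⊨? A) ⊎-dec (V? ⊨? B)
V? ⊨? A ⊃ B  = (V? ⊨? A) →-dec (V? ⊨? B)

-- Valuations are decidable so that case distinctions on truth are constructive. The valuation that
-- refutes an unprovable atomic sequent, membership in a finite list of atoms, is of this kind.
Valid : Sequent (Formula At) → Set₁
Valid s = ∀ {V} → Decidable V → Holds (V ⊨_) s

-- The base of truth-preserving rules and its soundness.

Pointwise-All : ∀ {P : Pred (Sequent At) 0ℓ} {ss ss′} → (∀ {s s′} → s ≈ s′ → P s′ → P s) →
                Pointwise _≈_ ss ss′ → All P ss′ → All P ss
Pointwise-All f []       []       = []
Pointwise-All f (e ∷ es) (x ∷ xs) = f e x ∷ Pointwise-All f es xs

truthBase : Pred At 0ℓ → Base At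
truthBase V .Rule (ps ╱ c) = All (Holds V) ps → Holds V c
truthBase V .respects (es , e) r = Holds-resp e ∘ r ∘ Pointwise-All (Holds-resp ∘ ≈-sym) es

truthBase⊇HS : (V : Pred At 0ℓ) → truthBase V ⊇ HS
truthBase⊇HS V (ainit Γ p Δ e) =
  respects (truthBase V) e (λ _ xs → here (All.head (Allₚ.++⁻ʳ Γ xs)))

module _ {V : Pred At 0ℓ} (V? : Decidable V) where

  -- If no atom of `Σ` is true, a true atom of the succedent must come from `s`.
  Holds-⊕ : ∀ Θ Σ {s} → Holds V ((Θ ⇒ Σ) ⊕ s) → All V Θ → Any V Σ ⊎ Holds V s
  Holds-⊕ Θ Σ h θ with any? V? Σ
  ... | yes σ = inj₁ σ
  ... | no ¬σ = inj₂ λ γ → [ (λ σ → contradiction σ ¬σ) , id ]′ (Anyₚ.++⁻ Σ (h (Allₚ.++⁺ θ γ)))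

  mutual
    truthBase-sound : ∀ {s} → truthBase V ⊢ s → Holds V s
    truthBase-sound (axiom r Θ Σ) = Anyₚ.++⁺ˡ ∘ r [] ∘ Allₚ.++⁻ʳ Θ
    truthBase-sound (mix {ctxs = ctxs} r ds) γ
      with truthBase-sound* ds (Allₚ.++⁻ˡ (Sequent.antecedent (⨁ ctxs)) γ)
    ... | inj₁ σ  = Anyₚ.++⁺ˡ σ
    ... | inj₂ hs = Anyₚ.++⁺ʳ (Sequent.succedent (⨁ ctxs))
                      (r hs (Allₚ.++⁻ʳ (Sequent.antecedent (⨁ ctxs)) γ))
    truthBase-sound (resp e d) = Holds-resp e (truthBase-sound d)

    -- Either some side context already makes the conclusion of the mix true, or every premise holds
    -- without its side context and the rule itself applies.
    truthBase-sound* : ∀ {ctxs ps} → Pointwise (λ ctx p → truthBase V ⊢ ctx ⊕ p) ctxs ps →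
      All V (Sequent.antecedent (⨁ ctxs)) → Any V (Sequent.succedent (⨁ ctxs)) ⊎ All (Holds V) ps
    truthBase-sound* [] _ = inj₂ []
    truthBase-sound* {(Θ ⇒ Σ) ∷ _} (d ∷ ds) θ
      with Holds-⊕ Θ Σ (truthBase-sound d) (Allₚ.++⁻ˡ Θ θ) | truthBase-sound* ds (Allₚ.++⁻ʳ Θ θ)
    ... | inj₁ σ | _       = inj₁ (Anyₚ.++⁺ˡ σ)
    ... | inj₂ _ | inj₁ σ  = inj₁ (Anyₚ.++⁺ʳ Σ σ)
    ... | inj₂ h | inj₂ hs = inj₂ (h ∷ hs)

  -- Support agrees with truth in extensions of `truthBase V`.

  private variable
    𝓒 : Base At
    Ψ : List At
    k : Support At

  -- Since `supp` at an atom just hands it to the continuation, erasing false formulas requires this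
  -- property of `k`.
  ErasesFalseAtoms : Support At → Set₁
  ErasesFalseAtoms k = ∀ {𝓒 p Ψ} → 𝓒 ⊇ truthBase V → ¬ V p → k 𝓒 (p ∷ Ψ) → k 𝓒 Ψ

  suppAt-erases : ErasesFalseAtoms suppAt
  suppAt-erases {p = p} {Ψ} e ¬p (lift d) = lift (resp (≋-refl , ≡⇒≋ identity)
    (mix {ps = ([] ⇒ p ∷ []) ∷ []} {c = [] ⇒ []} {ctxs = ([] ⇒ Ψ) ∷ []}
      -- A false `p` makes the premise ⇒ `p` fail, so the rule from it to the empty sequent
      -- preserves truth vacuously. The side context `Ψ` survives the mix.
      (e λ { (h ∷ []) _ → contradiction (Anyₚ.singleton⁻ (h [])) ¬p })
      (resp (≋-refl , ++-comm-≋ (p ∷ []) Ψ) d ∷ [])))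
    where
    identity : (Ψ ++ []) ++ [] ≡ Ψ
    identity rewrite ++-identityʳ Ψ = ++-identityʳ Ψ

  supp-erases : ∀ A → Mono k → ErasesFalseAtoms k → ErasesFalseAtoms (supp A k)
  supp-erases (atom q) m c e ¬p x = c e ¬p (m id (++-swap {At = At} (q ∷ []) (_ ∷ []) _) x)
  supp-erases bot      m c e ¬p x = c e ¬p x
  supp-erases (A ∧ B)  m c e ¬p (x , y) = supp-erases A m c e ¬p x , supp-erases B m c e ¬p y
  supp-erases (A ∨ B)  m c = supp-erases A (supp-mono B m) (supp-erases B m c)
  supp-erases (A ⊃ B)  m c e ¬p x 𝓓 e′ Θ a = supp-erases B m c (e′ ∘ e) ¬p
    (supp-mono B m id (++-swap {At = At} Θ (_ ∷ []) _) (x 𝓓 e′ Θ a))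

  supps-erases : ∀ Γ → ErasesFalseAtoms (supps Γ)
  supps-erases []      = suppAt-erases
  supps-erases (A ∷ Γ) = supp-erases A (supps-mono Γ) (supps-erases Γ)

  mutual
    -- The hypothesis `w` lets the rest of the context be weakened in. The induction is mutual with
    -- `supp-false`, since implication reverses the role of its antecedent.
    supp-true : ∀ A → Mono k → (∀ {𝓑 Ψ} → suppAt 𝓑 Ψ → k 𝓑 Ψ) →
                𝓒 ⊇ truthBase V → V ⊨ A → supp A k 𝓒 Ψ
    supp-true {Ψ = Ψ} (atom p) m w e t =
      w (lift (axiom {Γ = []} {Δ = p ∷ []} (e λ _ _ → here t) [] Ψ))
    supp-true (A ∧ B) m w e (s , t) = supp-true A m w e s , supp-true B m w e t
    supp-true (A ∨ B) m w e (inj₁ t) = supp-true A (supp-mono B m) (supp-weaken B m ∘ w) e t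
    supp-true (A ∨ B) m w e (inj₂ t) = supp-weaken A (supp-mono B m) (supp-true B m w e t)
    supp-true (A ⊃ B) m w e t 𝓓 e′ Θ a with V? ⊨? A
    ... | yes s = supp-true B m w (e′ ∘ e) (t s)
    -- With `A` false, `a` reduces to a derivation of ⇒ `Θ`, which weakening extends to the whole
    -- context.
    ... | no ¬s = supp-weaken B m (w (suppAt-mono id ∈-++⁺ˡ
                    (supp-false A suppAt-mono suppAt-erases (e′ ∘ e) ¬s a)))

    supp-false : ∀ A → Mono k → ErasesFalseAtoms k →
                 𝓒 ⊇ truthBase V → ¬ (V ⊨ A) → supp A k 𝓒 Ψ → k 𝓒 Ψ
    supp-false (atom p) m c e ¬t x = c e ¬t x
    supp-false bot      m c e ¬t x = x
    supp-false (A ∧ B)  m c e ¬t (x , y) with V? ⊨? A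
    ... | yes s = supp-false B m c e (λ t → ¬t (s , t)) y
    ... | no ¬s = supp-false A m c e ¬s x
    supp-false (A ∨ B)  m c e ¬t x = supp-false B m c e (¬t ∘ inj₂)
      (supp-false A (supp-mono B m) (supp-erases B m c) e (¬t ∘ inj₁) x)
    supp-false (A ⊃ B)  m c e ¬t x with V? ⊨? A
    -- The clause for implication is taken at the same base with `Θ` empty, where the true `A` is
    -- supported; the false `B` is then erased.
    ... | yes s = supp-false B m c e (λ t → ¬t λ _ → t)
                    (x _ id [] (supp-true A suppAt-mono id e s))
    ... | no ¬s = contradiction (λ s → contradiction s ¬s) ¬t

  -- From cut-free validity to classical validity.

  supps-false : ∀ {Γ} → 𝓒 ⊇ truthBase V → All (¬_ ∘ (V ⊨_)) Γ → supps Γ 𝓒 Ψ → suppAt 𝓒 Ψ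
  supps-false             e []        x = x
  supps-false {Γ = A ∷ Γ} e (¬t ∷ ¬γ) x =
    supps-false e ¬γ (supp-false A (supps-mono Γ) (supps-erases Γ) e ¬t x)

  -- If every formula of `Δ` were false, erasing them all would leave a derivation of the empty
  -- sequent, which soundness excludes.
  truthBase-⊩ : ∀ {Δ} → ⊩[ truthBase V ] Δ → Any (V ⊨_) Δ
  truthBase-⊩ {Δ} x with any? (V? ⊨?_) Δ
  ... | yes δ = δ
  ... | no ¬δ with () ← truthBase-sound (lower (supps-false id (¬Any⇒All¬ Δ ¬δ) x)) []

  supported-with-∅ : ∀ {Γ} → All (V ⊨_) Γ →
    Pointwise (λ Θ A → ⊩[ truthBase V ] map atom Θ ++ A ∷ []) (map (λ _ → []) Γ) Γ
  supported-with-∅             []      = []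
  supported-with-∅ {Γ = A ∷ _} (t ∷ γ) = supp-true A suppAt-mono id id t ∷ supported-with-∅ γ

  concat-∅ : (Γ : List (Formula At)) → concat {A = At} (map (λ _ → []) Γ) ≡ []
  concat-∅ []      = refl
  concat-∅ (_ ∷ Γ) = concat-∅ Γ

  -- For a nonempty antecedent, (Inf) is instantiated at `truthBase V` itself with every Θ empty,
  -- because true formulas are supported there outright.
  truthBase-⊩⇒Holds : ∀ Γ {Δ} → Γ ⊩[ truthBase V ] Δ → Holds (V ⊨_) (Γ ⇒ Δ)
  truthBase-⊩⇒Holds []        x _ = truthBase-⊩ x
  truthBase-⊩⇒Holds Γ@(_ ∷ _) {Δ} x γ =
    truthBase-⊩ (subst (λ Θ → ⊩[ truthBase V ] map atom Θ ++ Δ) (concat-∅ Γ)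
      (x _ id _ (supported-with-∅ γ)))

⊩cf⇒Valid : (Γ Δ : List (Formula At)) → Γ ⊩cf Δ → Valid (Γ ⇒ Δ)
⊩cf⇒Valid Γ Δ x {V} V? = truthBase-⊩⇒Holds V? Γ (x (truthBase V) (truthBase⊇HS V))

-- Completeness of CLp for classical validity.

module _ {At : Set} where

  private variable
    A B : Formula At
    Γ Δ : List (Formula At)

  -- The primed rules act at the head of a list and, by idempotence of union, share contexts between
  -- premises. In this shape validity passes from conclusion to premises.
  L∨′ : CLp⊢ (A ∷ Γ ⇒ Δ) → CLp⊢ (B ∷ Γ ⇒ Δ) → CLp⊢ (A ∨ B ∷ Γ ⇒ Δ)
  L∨′ {Γ = Γ} {Δ} d d′ =
    resp (++-cong (≋-refl {x = _ ∷ []}) (++-idempotent Γ) , ++-idempotent Δ) (L∨ d d′)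

  toLast : CLp⊢ (Γ ⇒ A ∷ Δ) → CLp⊢ (Γ ⇒ Δ ++ A ∷ [])
  toLast {Δ = Δ} = resp (≋-refl , ++-comm-≋ (_ ∷ []) Δ)

  toFirst : CLp⊢ (Γ ⇒ Δ ++ A ∷ []) → CLp⊢ (Γ ⇒ A ∷ Δ)
  toFirst {Δ = Δ} = resp (≋-refl , ++-comm-≋ Δ (_ ∷ []))

  L⊃′ : CLp⊢ (Γ ⇒ A ∷ Δ) → CLp⊢ (B ∷ Γ ⇒ Δ) → CLp⊢ (A ⊃ B ∷ Γ ⇒ Δ)
  L⊃′ {Γ = Γ} {Δ = Δ} d d′ =
    resp (++-cong (≋-refl {x = _ ∷ []}) (++-idempotent Γ) , ++-idempotent Δ) (L⊃ (toLast d) d′)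

  R∧′ : CLp⊢ (Γ ⇒ A ∷ Δ) → CLp⊢ (Γ ⇒ B ∷ Δ) → CLp⊢ (Γ ⇒ A ∧ B ∷ Δ)
  R∧′ {Γ = Γ} {Δ = Δ} d d′ = toFirst
    (resp (++-idempotent Γ , ≋-trans (≋-sym (≡⇒≋ (++-assoc Δ Δ _))) (++-cong (++-idempotent Δ) ≋-refl))
      (R∧ (toLast d) (toLast d′)))

  R∨′ : CLp⊢ (Γ ⇒ A ∷ B ∷ Δ) → CLp⊢ (Γ ⇒ A ∨ B ∷ Δ)
  R∨′ {Δ = Δ} d = toFirst (R∨ (resp (≋-refl , ++-comm-≋ (_ ∷ _ ∷ []) Δ) d))

  R⊃′ : CLp⊢ (A ∷ Γ ⇒ B ∷ Δ) → CLp⊢ (Γ ⇒ A ⊃ B ∷ Δ)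
  R⊃′ d = toFirst (R⊃ (toLast d))

  init-∈ : A ∈ Γ → A ∈ Δ → CLp⊢ (Γ ⇒ Δ)
  init-∈ {A} i j with Γ₁ , Γ₂ , refl ← ∈-∃++ i | Δ₁ , Δ₂ , refl ← ∈-∃++ j =
    resp ( ≋-trans (++-comm-≋ (Γ₁ ++ Γ₂) (A ∷ [])) (≋-sym (∷-swap-≋ A Γ₁ Γ₂))
         , ≋-sym (∷-swap-≋ A Δ₁ Δ₂))
      (init {Γ = Γ₁ ++ Γ₂} {Δ = Δ₁ ++ Δ₂})

  -- The atoms P and Q are those already extracted by decomposing formulas. Quantifying
  -- over them makes the decomposition of Γ ⇒ Δ a structural recursion on formulas.
  Complete : List (Formula At) → List (Formula At) → Set₁
  Complete Γ Δ = ∀ P Q → Valid (Γ ++ map atom P ⇒ Δ ++ map atom Q) →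
                 CLp⊢ (Γ ++ map atom P ⇒ Δ ++ map atom Q)

  mutual
    -- A compound `A` is decomposed by its invertible left rule, and an atom moves into `P` by
    -- reordering; `c` handles what remains once `A` is gone. Implication moves its antecedent to
    -- the other side, hence the mutual recursion.
    complete-L : ∀ A → Complete Γ Δ → Complete (A ∷ Γ) Δ
    complete-L {Γ = Γ} (atom p) c P Q v =
      resp (∷-swap-≋ (atom p) Γ _ , ≋-refl)
        (c (p ∷ P) Q λ V? → Holds-resp (≋-sym (∷-swap-≋ (atom p) Γ _) , ≋-refl) (v V?))
    complete-L {Γ = Γ} bot c P Q v =
      resp (++-comm-≋ (Γ ++ map atom P) (bot ∷ []) , ≋-refl) L⊥
    complete-L (A ∧ B) c P Q v = L∧ (complete-L A (complete-L B c) P Q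
      λ { V? (s ∷ t ∷ γ) → v V? ((s , t) ∷ γ) })
    complete-L (A ∨ B) c P Q v = L∨′
      (complete-L A c P Q λ { V? (s ∷ γ) → v V? (inj₁ s ∷ γ) })
      (complete-L B c P Q λ { V? (t ∷ γ) → v V? (inj₂ t ∷ γ) })
    complete-L (A ⊃ B) c P Q v = L⊃′
      -- If `A` fails, `A ⊃ B` is true, so validity of the conclusion gives a true formula in the
      -- remaining succedent.
      (complete-R A c P Q λ V? γ → case-A (V? ⊨? A) (λ ¬s → v V? ((λ s → contradiction s ¬s) ∷ γ)))
      (complete-L B c P Q λ { V? (t ∷ γ) → v V? ((λ _ → t) ∷ γ) })
      where
      case-A : ∀ {V} {Ξ} → Dec (V ⊨ A) → (¬ (V ⊨ A) → Any (V ⊨_) Ξ) → Any (V ⊨_) (A ∷ Ξ)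
      case-A (yes s) f = here s
      case-A (no ¬s) f = there (f ¬s)

    complete-R : ∀ A → Complete Γ Δ → Complete Γ (A ∷ Δ)
    complete-R {Δ = Δ} (atom p) c P Q v =
      resp (≋-refl , ∷-swap-≋ (atom p) Δ _)
        (c P (p ∷ Q) λ V? → Holds-resp (≋-refl , ≋-sym (∷-swap-≋ (atom p) Δ _)) (v V?))
    complete-R bot c P Q v = R⊥ (c P Q λ V? γ → case v V? γ of λ { (there δ) → δ })
    complete-R (A ∧ B) c P Q v = R∧′
      (complete-R A c P Q λ V? γ → mapHead proj₁ (v V? γ))
      (complete-R B c P Q λ V? γ → mapHead proj₂ (v V? γ))
      where
      mapHead : ∀ {V C D Ξ} → (V ⊨ C → V ⊨ D) → Any (V ⊨_) (C ∷ Ξ) → Any (V ⊨_) (D ∷ Ξ)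
      mapHead f (here t)  = here (f t)
      mapHead f (there δ) = there δ
    complete-R (A ∨ B) c P Q v = R∨′ (complete-R A (complete-R B c) P Q λ V? γ → split (v V? γ))
      where
      split : ∀ {V Ξ} → Any (V ⊨_) (A ∨ B ∷ Ξ) → Any (V ⊨_) (A ∷ B ∷ Ξ)
      split (here (inj₁ s)) = here s
      split (here (inj₂ t)) = there (here t)
      split (there δ)       = there (there δ)
    complete-R (A ⊃ B) c P Q v = R⊃′ (complete-L A (complete-R B c) P Q
      λ { V? (s ∷ γ) → apply s (v V? γ) })
      where
      apply : ∀ {V Ξ} → V ⊨ A → Any (V ⊨_) (A ⊃ B ∷ Ξ) → Any (V ⊨_) (B ∷ Ξ)
      apply s (here f)  = here (f s)
      apply s (there δ) = there δ

  -- The valuation making exactly the atoms of P true leaves an atom common to P and Q.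
  complete-atoms : DecidableEquality At → Complete [] []
  complete-atoms _≟ᴬ_ P Q v
    with q , q∈Q , q∈P ← find (Anyₚ.map⁻ (v (λ p → mem? _≟ᴬ_ p P) (Allₚ.map⁺ (All.tabulate id)))) =
    init-∈ (∈-map⁺ atom q∈P) (∈-map⁺ atom q∈Q)

  complete : DecidableEquality At → ∀ Γ Δ → Complete Γ Δ
  complete _≟ᴬ_ (A ∷ Γ) Δ       = complete-L A (complete _≟ᴬ_ Γ Δ)
  complete _≟ᴬ_ []      (A ∷ Δ) = complete-R A (complete _≟ᴬ_ [] Δ)
  complete _≟ᴬ_ []      []      = complete-atoms _≟ᴬ_

  Valid⇒CLp⊢ : DecidableEquality At → ∀ Γ Δ → Valid (Γ ⇒ Δ) → CLp⊢ (Γ ⇒ Δ)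
  Valid⇒CLp⊢ _≟ᴬ_ Γ Δ v = resp (≡⇒≋ (++-identityʳ Γ) , ≡⇒≋ (++-identityʳ Δ))
    (complete _≟ᴬ_ Γ Δ [] [] λ V? →
      Holds-resp (≡⇒≋ (sym (++-identityʳ Γ)) , ≡⇒≋ (sym (++-identityʳ Δ))) (v V?))

theorem4 : (At : Set) → At ↔ ℕ →
    (Γ Δ : List (Formula At)) → Γ ⊩cf Δ → CLp⊢ (Γ ⇒ Δ)
-- The bijection with ℕ supplies decidable equality of atoms.
theorem4 At At↔ℕ Γ Δ = Valid⇒CLp⊢ (via-injection (↔⇒↣ At↔ℕ) _≟_) Γ Δ ∘ ⊩cf⇒Valid Γ Δ
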